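{- The objective $$\text{Mean-Payoff}_{<0}=\Big\{w_0w_1\cdots\in\mathbb Z^\omega \;\Big|\; \limsup_{k}\frac1k\sum_{i=0}^{k-1}w_i<0\Big\}$$ over the alphabet $C=\mathbb Z$ is positional over arbitrary arenas.
   Context: **Graphs.** A $C$-graph $G$ is a (possibly infinite) set of vertices $V(G)$ with a set of edges $E(G)\subseteq V(G)\times C\times V(G)$; an edge $(v,c,v')$ is written $v\xrightarrow{c}v'$ and has label $c$. Every vertex is assumed to have at least one outgoing edge. A path is a sequence of edges with matching endpoints $v_0\xrightarrow{c_0}v_1\xrightarrow{c_1}\cdots$; its label is $c_0c_1\cdots$. $\mathrm{L}(G)\subseteq C^\omega$ is the set of labels of all infinite paths in $G$ (from any vertex). A morphism $G\to G'$ is a map $\phi\colon V(G)\to V(G')$ such that $v\xrightarrow{c}v'\in E(G)$ implies $\phi(v)\xrightarrow{c}\phi(v')\in E(G')$. **Games.** An objective is a set $W\subseteq C^\omega$. A graph $G$ satisfies $W$ if $\mathrm{L}(G)\subseteq W$. A $C$-arena $A$ is a $C$-graph with a partition $V(A)=V_{\mathrm{Eve}}\sqcup V_{\mathrm{Adam}}$. A strategy (for Eve) in $A$ is a pair $(S,\pi)$ with $S$ a $C$-graph and $\pi\colon S\to A$ a surjective (on vertices) morphism such that for every $v\in V_{\mathrm{Adam}}$, every edge $v\xrightarrow{c}v'\in E(A)$ and every $s\in\pi^{ -1}(v)$, there is an edge $s\xrightarrow{c}s'\in E(S)$ with $\pi(s')=v'$. The strategy is positional if $\pi$ is injective. Eve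 wins the game $(A,W)$ with $(S,\pi)$ if $S$ satisfies $W$; she wins $(A,W)$ if some such strategy exists. $W$ is positional over arbitrary arenas if for every $C$-arena $A$, whenever Eve wins $(A,W)$, she wins $(A,W)$ with a positional strategy. Limits superior are taken in the extended real line. -}

module Defs where

open import Data.Fin.Base using (toℕ)
open import Data.Integer.Base using (ℤ)
import Data.Integer.Properties as ℤ
open import Data.Nat.Base as ℕ using (ℕ; suc)
open import Data.Product using (Σ-syntax; ∃-syntax; _×_; _,_)
open import Data.Rational.Base as ℚ using (ℚ; 0ℚ; _/_)
import Data.Rational.Properties as ℚ
open import Function.Bundles using (_⇔_; mk⇔; module Equivalence)
open import Function.Definitions using (Injective; Surjective)
open import Level using (Level; _⊔_; 0ℓ) renaming (suc to lsuc)
open import Relation.Binary.PropositionalEquality using (_≡_)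
open import Relation.Nullary using (¬_)
open import Relation.Unary using (Pred; _⊆_)

open import Algebra.Properties.CommutativeMonoid.Sum ℤ.+-0-commutativeMonoid
  using (sum-syntax)

private
  variable
    c ℓ w : Level

-- Infinite words over C, i.e. C^ω.
Word : Set c → Set c
Word C = ℕ → C

Objective : Set c → (w : Level) → Set (c ⊔ lsuc w)
Objective C w = Pred (Word C) w

-- Only whether Edge v x v′ is inhabited matters: a triple is an edge or not,
-- so this is a set of edges contained in V × C × V.
record Graph (C : Set c) (ℓ : Level) : Set (c ⊔ lsuc ℓ) where
  field
    Vertex   : Set ℓ
    Edge     : Vertex → C → Vertex → Set ℓ
    sinkless : ∀ v → ∃[ x ] ∃[ v′ ] Edge v x v′

open Graph public

L : {C : Set c} → Graph C ℓ → Pred (Word C) ℓ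
L G u = Σ[ v ∈ (ℕ → Vertex G) ] (∀ n → Edge G (v n) (u n) (v (suc n)))

Satisfies : {C : Set c} → Graph C ℓ → Objective C w → Set (c ⊔ ℓ ⊔ w)
Satisfies G W = L G ⊆ W

record Morphism {C : Set c} (G G′ : Graph C ℓ) : Set (c ⊔ ℓ) where
  field
    map       : Vertex G → Vertex G′
    preserves : ∀ {v x v′} → Edge G v x v′ → Edge G′ (map v) x (map v′)

data Player : Set where
  Eve Adam : Player

record Arena (C : Set c) (ℓ : Level) : Set (c ⊔ lsuc ℓ) where
  field
    graph : Graph C ℓ
    owner : Vertex graph → Player

record Strategy {C : Set c} (A : Arena C ℓ) : Set (c ⊔ lsuc ℓ) where
  open Arena A
  field
    S  : Graph C ℓ
    pi : Morphism S graph

  π : Vertex S → Vertex graph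
  π = Morphism.map pi

  field
    surjective : Surjective _≡_ _≡_ π
    adamMoves  : ∀ s → owner (π s) ≡ Adam →
                 ∀ {x v′} → Edge graph (π s) x v′ →
                 ∃[ s′ ] (Edge S s x s′ × π s′ ≡ v′)

WinsWith : {C : Set c} {A : Arena C ℓ} →
           Strategy A → Objective C w → Set (c ⊔ ℓ ⊔ w)
WinsWith σ W = Satisfies (Strategy.S σ) W

EveWins : {C : Set c} → Arena C ℓ → Objective C w → Set (c ⊔ lsuc ℓ ⊔ w)
EveWins A W = Σ[ σ ∈ Strategy A ] WinsWith σ W

Positional : {C : Set c} {A : Arena C ℓ} → Strategy A → Set ℓ
Positional σ = Injective _≡_ _≡_ (Strategy.π σ)

EveWinsPositionally : {C : Set c} →
                      Arena C ℓ → Objective C w → Set (c ⊔ lsuc ℓ ⊔ w)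
EveWinsPositionally A W = Σ[ σ ∈ Strategy A ] (Positional σ × WinsWith σ W)

-- The level ℓ bounds the size of arenas and strategies; "arbitrary arenas"
-- means that this holds for every ℓ.
PositionalOverArenas : {C : Set c} →
                       (ℓ : Level) → Objective C w → Set (c ⊔ lsuc ℓ ⊔ w)
PositionalOverArenas {C = C} ℓ W =
  (A : Arena C ℓ) → EveWins A W → EveWinsPositionally A W

-- Extended reals as upper Dedekind cuts: x is given by the set of rationals
-- strictly above x.  The empty cut is +∞ and the full cut is -∞.
record ℝ̄ : Set₁ where
  field
    above   : ℚ → Set
    rounded : ∀ {q} → above q ⇔ (∃[ r ] (r ℚ.< q × above r))

open ℝ̄ public

fromℚ : ℚ → ℝ̄
fromℚ p .above q = p ℚ.< q
fromℚ p .rounded = mk⇔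
  (λ p<q → let r , p<r , r<q = ℚ.<-dense p<q in r , r<q , p<r)
  (λ (r , r<q , p<r) → ℚ.<-trans p<r r<q)

-- x < y iff some rational q satisfies x < q ≤ y.
infix 4 _<_
_<_ : ℝ̄ → ℝ̄ → Set
x < y = ∃[ q ] (above x q × ¬ above y q)

-- sup x < q iff some rational r < q is strictly above every x i.
sup : {I : Set} → (I → ℝ̄) → ℝ̄
sup x .above q = ∃[ r ] (r ℚ.< q × (∀ i → above (x i) r))
sup x .rounded = mk⇔
  (λ (r , r<q , h) → let m , r<m , m<q = ℚ.<-dense r<q
                     in m , m<q , r , r<m , h)
  (λ (m , m<q , r , r<m , h) → r , ℚ.<-trans r<m m<q , h)

inf : {I : Set} → (I → ℝ̄) → ℝ̄
inf x .above q = ∃[ i ] above (x i) q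
inf x .rounded = mk⇔
  (λ (i , h) → let r , r<q , h′ = to (rounded (x i)) h in r , r<q , i , h′)
  (λ (r , r<q , i , h) → i , from (rounded (x i)) (r , r<q , h))
  where open Equivalence

limsup : (ℕ → ℝ̄) → ℝ̄
limsup a = inf λ n → sup λ k → a (n ℕ.+ k)

-- The average of the first suc j letters.  Indexing from k = suc j avoids
-- division by zero and does not affect the limit superior.
mean : Word ℤ → ℕ → ℚ
mean u j = (∑[ i < suc j ] u (toℕ i)) / suc j

MeanPayoff<0 : Objective ℤ 0ℓ
MeanPayoff<0 u = limsup (λ j → fromℚ (mean u j)) < fromℚ 0ℚ

{-# OPTIONS --safe #-}
-- Every vertex s of a winning strategy receives a rank (α , n , e).  The ordinal
-- α is the stage of a transfinite iteration: s enters at stage α if, for some n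
-- and e, every finite path from s that avoids the earlier stages has total cost
-- at most e, where a letter w costs (n + 1) w + 1.  All vertices enter at some
-- stage: in the graph of the remaining ones, one could string together paths of
-- larger and larger costs for n = 0, 1, 2, …, and obtain a play with nonnegative
-- limsup.  Ranking a vertex of the arena by the lexicographically least rank in
-- its fibre, Eve keeps the edges along which the rank decreases in (α , n), or
-- (α , n) does not increase and e pays for the cost of the letter.  On a play of
-- such edges (α , n) is eventually constant, so the remaining costs are bounded
-- and the mean payoff is at most -1/(n + 1).  Eve may keep several edges at a
-- vertex, so no choice among them is needed.
module Submission where

open import Defs hiding (_<_)
open import Axiom.ExcludedMiddle using (ExcludedMiddle)

open import Data.Empty.Polymorphic using (⊥)
open import Data.Integer.Base
  using (ℤ; +_; -[1+_]; 0ℤ; -1ℤ; _+_; _*_; _-_; -_; ∣_∣; _≤_; _<_; -≤+; +≤+; -≤-; -<+; +<+)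
open import Data.Integer.Properties
  using (+-0-commutativeMonoid; +-identityˡ; +-identityʳ; +-assoc; +-comm; +-inverseʳ; *-comm;
         *-identityʳ; *-zeroʳ; *-monoˡ-≤-nonNeg; *-monoʳ-≤-nonNeg; *-monoʳ-≤-nonPos;
         +-mono-≤; +-monoˡ-≤; +-monoʳ-≤; +-monoˡ-<; 0≤i⇒+∣i∣≡i; i≤j⇒0≤j-i;
         ≤-refl; ≤-reflexive; ≤-trans; <⇒≤; <⇒≱; ≮⇒≥; module ≤-Reasoning)
open import Data.Integer.Tactic.RingSolver using (solve-∀)
open import Data.Nat.Base as ℕ using (ℕ; zero; suc; z≤n; s≤s)
import Data.Nat.Induction as ℕ
import Data.Nat.Properties as ℕ
open import Data.Fin.Base using (toℕ)
open import Data.Product using (Σ; Σ-syntax; ∃; ∃-syntax; _×_; _,_; proj₁; proj₂)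
open import Data.Rational.Base as ℚ using (0ℚ; fromℚᵘ; ↥_; ↧_)
import Data.Rational.Properties as ℚ
open import Data.Rational.Unnormalised.Base as ℚᵘ using (mkℚᵘ; *<*)
import Data.Rational.Unnormalised.Properties as ℚᵘ
open import Data.Sum.Base using (_⊎_; inj₁; inj₂)
open import Function.Base using (id; _∘_)
open import Induction.WellFounded using (WellFounded; Acc; acc)
open import Level using (Level; _⊔_) renaming (suc to lsuc)
open import Relation.Binary.Construct.Closure.Transitive using (TransClosure; [_]; _∷_)
open import Relation.Binary.Core using (Rel)
open import Relation.Binary.PropositionalEquality
  using (_≡_; refl; sym; trans; cong; subst; subst₂)
open import Relation.Nullary using (¬_; yes; no; contradiction)
open import Relation.Nullary.Decidable using (decidable-stable)
open import Relation.Unary using (Pred)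

open import Algebra.Properties.CommutativeMonoid.Sum +-0-commutativeMonoid
  using (sum-syntax)

private
  variable
    a ℓ p r : Level

-- Costs of words and their relation to the mean payoff.

prefixSum : Word ℤ → ℕ → ℤ
prefixSum u m = ∑[ i < m ] u (toℕ i)

prefixSum-+ : ∀ u i m →
  prefixSum u (i ℕ.+ m) ≡ prefixSum u i + prefixSum (λ k → u (i ℕ.+ k)) m
prefixSum-+ u zero    m = sym (+-identityˡ _)
prefixSum-+ u (suc i) m = trans (cong (_+_ (u 0)) (prefixSum-+ (u ∘ suc) i m))
                                (sym (+-assoc (u 0) _ _))

prefixSum-suc : ∀ u m → prefixSum u (suc m) ≡ prefixSum u m + u m
prefixSum-suc u zero    = +-comm (u 0) 0ℤ
prefixSum-suc u (suc m) = trans (cong (_+_ (u 0)) (prefixSum-suc (u ∘ suc) m))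
                                (sym (+-assoc (u 0) _ _))

-- For `m > 0` letters with sum `T`, negative exactly when their mean is below `-1/(n + 1)`.
cost : ℕ → ℤ → ℕ → ℤ
cost n T m = + suc n * T + + m

cost-+ : ∀ n T T′ m m′ → cost n (T + T′) (m ℕ.+ m′) ≡ cost n T m + cost n T′ m′
cost-+ n T T′ m m′ = lemma (+ suc n) T T′ (+ m) (+ m′)
  where
  lemma : ∀ d T T′ m m′ → d * (T + T′) + (m + m′) ≡ (d * T + m) + (d * T′ + m′)
  lemma = solve-∀

cost-step : ∀ n T w m → cost n (T + w) (suc m) ≡ cost n T m + cost n w 1
cost-step n T w m = trans (cong (cost n (T + w)) (ℕ.+-comm 1 m)) (cost-+ n T w m 1)

i≤+∣i∣ : ∀ i → i ≤ + ∣ i ∣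
i≤+∣i∣ (+ n)    = ≤-refl
i≤+∣i∣ -[1+ n ] = -≤+

-- A nonnegative `T` never hurts, and a negative one weighs less at smaller `n`. This brings costs
-- found at ever larger parameters down to one fixed `n`.
cost-nonneg-anti : ∀ {n n′} T m → n ℕ.≤ n′ → 0ℤ ≤ cost n′ T m → 0ℤ ≤ cost n T m
cost-nonneg-anti {n} (+ T) m _ _ =
  +-mono-≤ (≤-trans (≤-reflexive (sym (*-zeroʳ (+ suc n))))
                    (*-monoˡ-≤-nonNeg (+ suc n) (+≤+ {0} {T} z≤n)))
           (+≤+ {0} {m} z≤n)
cost-nonneg-anti T@(-[1+ _ ]) m n≤n′ 0≤c =
  ≤-trans 0≤c (+-monoˡ-≤ (+ m) (*-monoʳ-≤-nonPos T (+≤+ (s≤s n≤n′))))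

mean<⇒ : ∀ u j q → mean u j ℚ.< q → prefixSum u (suc j) * ↧ q < ↥ q * + suc j
mean<⇒ u j q@record{} lt =
  ℚᵘ.drop-*<* (ℚᵘ.<-respˡ-≃ (ℚ.toℚᵘ-fromℚᵘ (mkℚᵘ (prefixSum u (suc j)) j))
                            (ℚ.toℚᵘ-mono-< lt))

⇒mean< : ∀ u j n d → prefixSum u (suc j) * + suc d < n * + suc j →
         mean u j ℚ.< fromℚᵘ (mkℚᵘ n d)
⇒mean< u j n d lt = ℚ.toℚᵘ-cancel-<
  (ℚᵘ.<-respʳ-≃ (ℚᵘ.≃-sym (ℚ.toℚᵘ-fromℚᵘ (mkℚᵘ n d)))
  (ℚᵘ.<-respˡ-≃ (ℚᵘ.≃-sym (ℚ.toℚᵘ-fromℚᵘ (mkℚᵘ (prefixSum u (suc j)) j)))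
  (*<* lt)))

<0⇒↥<0 : ∀ q → q ℚ.< 0ℚ → ↥ q ≤ -1ℤ
<0⇒↥<0 (ℚ.mkℚ (+ n) d _)    (ℚ.*<* lt) with subst (_< 0ℤ) (*-identityʳ (+ n)) lt
... | +<+ ()
<0⇒↥<0 (ℚ.mkℚ -[1+ n ] d _) _          = -≤- z≤n

-- Some rational `s < 0` lies above all means from index `N` on. Its numerator is at most -1, so `s`
-- is at most `-1/(n + 1)` when `n + 1` is its denominator.
MeanPayoff<0⇒cost<0 : ∀ {u} → MeanPayoff<0 u →
  ∃[ n ] ∃[ N ] ∀ m → N ℕ.≤ m → cost n (prefixSum u (suc m)) (suc m) < 0ℤ
MeanPayoff<0⇒cost<0 {u} (q , (N , s , s<q , h) , 0≮q) =
  ℚ.ℚ.denominator-1 s , N , λ m N≤m →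
    bound m (subst (λ k → mean u k ℚ.< s) (ℕ.m+[n∸m]≡n N≤m) (h (m ℕ.∸ N)))
  where
  s<0 : s ℚ.< 0ℚ
  s<0 = ℚ.<-≤-trans s<q (ℚ.≮⇒≥ 0≮q)

  bound : ∀ m → mean u m ℚ.< s → cost (ℚ.ℚ.denominator-1 s) (prefixSum u (suc m)) (suc m) < 0ℤ
  bound m lt = begin-strict
    ↧ s * T + + suc m          ≡⟨ cong (_+ + suc m) (*-comm (↧ s) T) ⟩
    T * ↧ s + + suc m          <⟨ +-monoˡ-< (+ suc m) (mean<⇒ u m s lt) ⟩
    ↥ s * + suc m + + suc m    ≤⟨ +-monoˡ-≤ (+ suc m) (*-monoʳ-≤-nonNeg (+ suc m) (<0⇒↥<0 s s<0)) ⟩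
    -1ℤ * + suc m + + suc m    ≡⟨ lemma (+ suc m) ⟩
    0ℤ                         ∎
    where
    open ≤-Reasoning
    T = prefixSum u (suc m)
    lemma : ∀ x → -1ℤ * x + x ≡ 0ℤ
    lemma = solve-∀

-- With B bounding the costs of all prefixes longer than i, half of the drift
-- -1/(n + 1) absorbs B once the length exceeds 2 ∣ B ∣.
costBounded⇒MeanPayoff<0 : ∀ {u} i n e →
  (∀ m → cost n (prefixSum (λ k → u (i ℕ.+ k)) m) m ≤ e) → MeanPayoff<0 u
costBounded⇒MeanPayoff<0 {u} i n e h =
  0ℚ , (i ℕ.+ K , s , s<0 , λ k → ⇒mean< u (i ℕ.+ K ℕ.+ k) -1ℤ (n ℕ.+ suc n) (bound k)) ,
  ℚ.<-irrefl refl
  where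
  B = cost n (prefixSum u i) i + e
  K = ∣ B ∣ ℕ.+ ∣ B ∣
  s = fromℚᵘ (mkℚᵘ -1ℤ (n ℕ.+ suc n))

  s<0 : s ℚ.< 0ℚ
  s<0 = ℚ.toℚᵘ-cancel-<
    (ℚᵘ.<-respˡ-≃ (ℚᵘ.≃-sym (ℚ.toℚᵘ-fromℚᵘ (mkℚᵘ -1ℤ (n ℕ.+ suc n)))) (*<* -<+))

  prefix : ∀ m → cost n (prefixSum u (i ℕ.+ m)) (i ℕ.+ m) ≤ B
  prefix m = begin
    cost n (prefixSum u (i ℕ.+ m)) (i ℕ.+ m)
      ≡⟨ cong (λ T → cost n T (i ℕ.+ m)) (prefixSum-+ u i m) ⟩
    cost n (prefixSum u i + prefixSum (λ k → u (i ℕ.+ k)) m) (i ℕ.+ m)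
      ≡⟨ cost-+ n (prefixSum u i) (prefixSum (λ k → u (i ℕ.+ k)) m) i m ⟩
    cost n (prefixSum u i) i + cost n (prefixSum (λ k → u (i ℕ.+ k)) m) m
      ≤⟨ +-monoʳ-≤ (cost n (prefixSum u i) i) (h m) ⟩
    B ∎
    where open ≤-Reasoning

  bound : ∀ k → prefixSum u (suc (i ℕ.+ K ℕ.+ k)) * + suc (n ℕ.+ suc n)
              < -1ℤ * + suc (i ℕ.+ K ℕ.+ k)
  bound k = begin-strict
    T * (+ suc n + + suc n)                    ≡⟨ lemma₁ T (+ suc n) J ⟩
    cost n T j + cost n T j + - (J + J)        ≤⟨ +-monoˡ-≤ (- (J + J)) (+-mono-≤ c≤B c≤B) ⟩
    B + B + - (J + J)                          ≤⟨ +-monoˡ-≤ (- (J + J)) (+-mono-≤ (i≤+∣i∣ B) (i≤+∣i∣ B)) ⟩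
    + K + - (J + J)                            <⟨ +-monoˡ-< (- (J + J)) K<J ⟩
    J + - (J + J)                              ≡⟨ lemma₂ J ⟩
    -1ℤ * J                                    ∎
    where
    open ≤-Reasoning
    j = suc (i ℕ.+ K ℕ.+ k)
    J = + j
    T = prefixSum u j
    c≤B : cost n T j ≤ B
    c≤B = subst (λ m → cost n (prefixSum u m) m ≤ B)
            (trans (ℕ.+-suc i (K ℕ.+ k)) (cong suc (sym (ℕ.+-assoc i K k)))) (prefix (suc (K ℕ.+ k)))
    K<J : + K < J
    K<J = +<+ (s≤s (ℕ.≤-trans (ℕ.m≤n+m K i) (ℕ.m≤m+n (i ℕ.+ K) k)))
    lemma₁ : ∀ T d J → T * (d + d) ≡ (d * T + J) + (d * T + J) + - (J + J)
    lemma₁ = solve-∀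
    lemma₂ : ∀ J → J + - (J + J) ≡ -1ℤ * J
    lemma₂ = solve-∀

-- Infinite concatenation of finite paths.

module Concatenation {H : Set a} (_⟶_ : Rel H r) (Q : ℕ → Pred H p)
  (extend : ∀ t x → ∃[ y ] (TransClosure _⟶_ x y × Q t y)) where

  -- `pending` is what is left of the current finite path. It is never empty, so each `next` walks
  -- exactly one edge.
  record State : Set (a ⊔ r) where
    constructor state
    field
      stage       : ℕ
      {here goal} : H
      pending     : TransClosure _⟶_ here goal

  open State

  start : ℕ → H → State
  start t x = state t (proj₁ (proj₂ (extend t x)))

  next : State → State
  next (state t {goal = z} [ _ ])  = start (suc t) z
  next (state t (_ ∷ ps))          = state t ps

  here⟶here-next : ∀ s → here s ⟶ here (next s)
  here⟶here-next (state _ [ e ])   = e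
  here⟶here-next (state _ (e ∷ _)) = e

  module _ (x₀ : H) where

    run : ℕ → State
    run zero    = start 0 x₀
    run (suc i) = next (run i)

    reach : ∀ {t x z} (ps : TransClosure _⟶_ x z) i → run i ≡ state t ps →
            ∃[ j ] (i ℕ.≤ j × run (suc j) ≡ start (suc t) z)
    reach [ _ ]    i eq = i , ℕ.≤-refl , cong next eq
    reach (_ ∷ ps) i eq = let j , i<j , eq′ = reach ps (suc i) (cong next eq)
                          in j , ℕ.<⇒≤ i<j , eq′

    stages : ∀ t → ∃[ i ] (t ℕ.≤ i × ∃[ x ] run i ≡ start t x)
    stages zero    = 0 , z≤n , x₀ , refl
    stages (suc t) = let i , t≤i , x , eq = stages t
                         j , i≤j , eq′   = reach _ i eq
                     in suc j , s≤s (ℕ.≤-trans t≤i i≤j) , _ , eq′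

    -- Each stage walks at least one edge, so the goal of stage `t` is reached after more than `t`
    -- steps.
    infinitePath : Σ[ h ∈ (ℕ → H) ] (h 0 ≡ x₀ × (∀ i → h i ⟶ h (suc i)) ×
                                     (∀ t → ∃[ j ] (t ℕ.≤ j × Q t (h (suc j)))))
    infinitePath = here ∘ run , refl , here⟶here-next ∘ run , λ t →
      let i , t≤i , x , eq = stages t
          j , i≤j , eq′   = reach _ i eq
      in j , ℕ.≤-trans t≤i i≤j ,
         subst (Q t) (sym (cong here eq′)) (proj₂ (proj₂ (extend t x)))

-- Ordinals as trees, and lexicographic ranks.

data Ord (ℓ : Level) : Set (lsuc ℓ) where
  sup⁺ : {I : Set ℓ} → (I → Ord ℓ) → Ord ℓ

infix 4 _≤ₒ_ _<ₒ_

-- `sup⁺ f` stands for the least ordinal strictly above all `f i`; distinct trees may represent the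
-- same ordinal.
_≤ₒ_ : Ord ℓ → Ord ℓ → Set ℓ
sup⁺ f ≤ₒ sup⁺ g = ∀ i → ∃[ j ] f i ≤ₒ g j

_<ₒ_ : Ord ℓ → Ord ℓ → Set ℓ
α <ₒ sup⁺ g = ∃[ j ] α ≤ₒ g j

≤ₒ-refl : (α : Ord ℓ) → α ≤ₒ α
≤ₒ-refl (sup⁺ f) i = i , ≤ₒ-refl (f i)

≤ₒ-trans : (α β γ : Ord ℓ) → α ≤ₒ β → β ≤ₒ γ → α ≤ₒ γ
≤ₒ-trans (sup⁺ f) (sup⁺ g) (sup⁺ h) α≤β β≤γ i =
  let j , fi≤gj = α≤β i ; k , gj≤hk = β≤γ j in k , ≤ₒ-trans (f i) (g j) (h k) fi≤gj gj≤hk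

≤-<ₒ-trans : (α β γ : Ord ℓ) → α ≤ₒ β → β <ₒ γ → α <ₒ γ
≤-<ₒ-trans α β (sup⁺ h) α≤β (k , β≤hk) = k , ≤ₒ-trans α β (h k) α≤β β≤hk

<-≤ₒ-trans : (α β γ : Ord ℓ) → α <ₒ β → β ≤ₒ γ → α <ₒ γ
<-≤ₒ-trans α (sup⁺ g) (sup⁺ h) (j , α≤gj) β≤γ =
  let k , gj≤hk = β≤γ j in k , ≤ₒ-trans α (g j) (h k) α≤gj gj≤hk

<ₒ⇒≤ₒ : (α β : Ord ℓ) → α <ₒ β → α ≤ₒ β
<ₒ⇒≤ₒ (sup⁺ f) (sup⁺ g) (j , α≤gj) i = j , <ₒ⇒≤ₒ (f i) (g j) (fi< (g j) α≤gj)
  where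
  fi< : ∀ γ → sup⁺ f ≤ₒ γ → f i <ₒ γ
  fi< (sup⁺ h) α≤γ = α≤γ i

accₒ-≤ : {α β : Ord ℓ} → α ≤ₒ β → Acc _<ₒ_ β → Acc _<ₒ_ α
accₒ-≤ {α = α} {β} α≤β (acc rs) = acc λ {γ} γ<α → rs (<-≤ₒ-trans γ α β γ<α α≤β)

-- A predecessor of `sup⁺ g` is `≤ₒ` some subtree `g j`, and accessibility passes down along `≤ₒ`.
<ₒ-wellFounded : WellFounded (_<ₒ_ {ℓ})
<ₒ-wellFounded (sup⁺ g) = acc λ (j , α≤gj) → accₒ-≤ α≤gj (<ₒ-wellFounded (g j))

Rank : (ℓ : Level) → Set (lsuc ℓ)
Rank ℓ = Ord ℓ × ℕ × ℕ

-- Equality of trees would be too fine, hence `≤ₒ` in the second case. The parameter `R` covers the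
-- strict order, the weak order and payments alike.
Lex : (ℕ → ℕ → ℕ → Set) → Rank ℓ → Rank ℓ → Set ℓ
Lex R (α , n , e) (β , m , f) = α <ₒ β ⊎ (α ≤ₒ β × (n ℕ.< m ⊎ (n ≡ m × R m e f)))

Lex-trans : ∀ {R S T : ℕ → ℕ → ℕ → Set} → (∀ {n e f g} → R n e f → S n f g → T n e g) →
            (k k′ k″ : Rank ℓ) → Lex R k k′ → Lex S k′ k″ → Lex T k k″
Lex-trans comp (α , _) (β , _) (γ , _) (inj₁ x) (inj₁ y) =
  inj₁ (≤-<ₒ-trans α β γ (<ₒ⇒≤ₒ α β x) y)
Lex-trans comp (α , _) (β , _) (γ , _) (inj₁ x) (inj₂ (y , _)) = inj₁ (<-≤ₒ-trans α β γ x y)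
Lex-trans comp (α , _) (β , _) (γ , _) (inj₂ (x , _)) (inj₁ y) = inj₁ (≤-<ₒ-trans α β γ x y)
Lex-trans comp (α , _) (β , _) (γ , _) (inj₂ (x , s)) (inj₂ (y , t)) =
  inj₂ (≤ₒ-trans α β γ x y , tail s t)
  where
  tail : _ → _ → _
  tail (inj₁ x)          (inj₁ y)          = inj₁ (ℕ.<-trans x y)
  tail (inj₁ x)          (inj₂ (refl , _)) = inj₁ x
  tail (inj₂ (refl , _)) (inj₁ y)          = inj₁ y
  tail (inj₂ (refl , r)) (inj₂ (refl , s)) = inj₂ (refl , comp r s)

infix 4 _≺_ _≼_

_≺_ _≼_ : Rank ℓ → Rank ℓ → Set ℓ
_≺_ = Lex λ _ → ℕ._<_
_≼_ = Lex λ _ → ℕ._≤_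

≺-wellFounded : WellFounded (_≺_ {ℓ})
≺-wellFounded (α , n , e) =
  go (<ₒ-wellFounded α) (ℕ.<-wellFounded n) (ℕ.<-wellFounded e) (≤ₒ-refl α)
  where
  -- The ordinal may change without a strict drop. Accessibility is therefore kept for a fixed `α`,
  -- with the current `β` only known to be `≤ₒ α`.
  go : ∀ {α n e} → Acc _<ₒ_ α → Acc ℕ._<_ n → Acc ℕ._<_ e →
       ∀ {β} → β ≤ₒ α → Acc _≺_ (β , n , e)
  descend : ∀ {α n e} → Acc _<ₒ_ α → Acc ℕ._<_ n → Acc ℕ._<_ e →
            ∀ {β} → β ≤ₒ α → ∀ {k} → k ≺ (β , n , e) → Acc _≺_ k

  go accα accn acce β≤α = acc (descend accα accn acce β≤α)

  descend {α} (acc accα) _ _ {β} β≤α {γ , m , f} (inj₁ γ<β) =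
    go (accα (<-≤ₒ-trans γ β α γ<β β≤α)) (ℕ.<-wellFounded m) (ℕ.<-wellFounded f) (≤ₒ-refl γ)
  descend {α} accα (acc accn) _ {β} β≤α {γ , m , f} (inj₂ (γ≤β , inj₁ m<n)) =
    go accα (accn m<n) (ℕ.<-wellFounded f) (≤ₒ-trans γ β α γ≤β β≤α)
  descend {α} accα accn (acc acce) {β} β≤α {γ , _ , f} (inj₂ (γ≤β , inj₂ (refl , f<e))) =
    go accα accn (acce f<e) (≤ₒ-trans γ β α γ≤β β≤α)

-- Payments, bounded paths and the stages of the iteration.

Pays : ℤ → ℕ → ℕ → ℕ → ℕ → Set
Pays T m n e′ e = cost n T m + + e′ ≤ + e

Pays-step : ∀ T m w {n e″ e′ e} → Pays w 1 n e″ e′ → Pays T m n e′ e →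
            Pays (T + w) (suc m) n e″ e
Pays-step T m w {n} {e″} {e′} {e} w-pays T-pays = begin
  cost n (T + w) (suc m) + + e″        ≡⟨ cong (_+ + e″) (cost-step n T w m) ⟩
  cost n T m + cost n w 1 + + e″       ≡⟨ +-assoc (cost n T m) (cost n w 1) (+ e″) ⟩
  cost n T m + (cost n w 1 + + e″)     ≤⟨ +-monoʳ-≤ (cost n T m) w-pays ⟩
  cost n T m + + e′                    ≤⟨ T-pays ⟩
  + e                                  ∎
  where open ≤-Reasoning

module _ (S : Graph ℤ ℓ) where

  -- The integer index is the cost at parameter `n`, not the sum of the letters. The first vertex
  -- may lie in `Y`.
  data Path (Y : Pred (Vertex S) ℓ) (n : ℕ) : Vertex S → ℤ → Vertex S → Set ℓ where
    nil  : ∀ {s} → Path Y n s 0ℤ s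
    cons : ∀ {s w s′ c t} → Edge S s w s′ → ¬ Y s′ → Path Y n s′ c t →
           Path Y n s (cost n w 1 + c) t

  Bounded : Pred (Vertex S) ℓ → ℕ → ℕ → Pred (Vertex S) ℓ
  Bounded Y n e s = ∀ c t → Path Y n s c t → c ≤ + e

  Below : Ord ℓ → Pred (Vertex S) ℓ
  Below (sup⁺ f) s = ∃[ i ] ∃[ n ] ∃[ e ] Bounded (Below (f i)) n e s

  Admits : Rank ℓ → Pred (Vertex S) ℓ
  Admits (α , n , e) = Bounded (Below α) n e

-- Linearity of the orders, and plays on which every letter is paid for.

module Classical (em : ∀ {a} → ExcludedMiddle a) where

  dne : {A : Set a} → ¬ ¬ A → A
  dne = decidable-stable em

  abstract
    minimal : {A : Set a} {_<_ : Rel A r} {P : Pred A p} → WellFounded _<_ →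
              ∃ P → ∃[ x ] (P x × ∀ {y} → P y → ¬ y < x)
    minimal {_<_ = _<_} {P} wf (x , px) = go (wf x) px
      where
      go : ∀ {x} → Acc _<_ x → P x → ∃[ x ] (P x × ∀ {y} → P y → ¬ y < x)
      go {x} (acc rs) px with em {P = ∃[ y ] (P y × y < x)}
      ... | yes (y , py , y<x) = go (rs y<x) py
      ... | no none            = x , px , λ py y<x → none (_ , py , y<x)

  -- Some `f i` is `≤ₒ` no `g j`. By induction every `g j` is then strictly below this `f i`, which
  -- thus witnesses the strict inequality.
  ≰ₒ⇒>ₒ : (α β : Ord ℓ) → ¬ α ≤ₒ β → β <ₒ α
  ≰ₒ⇒>ₒ (sup⁺ f) (sup⁺ g) α≰β = dne λ β≮α → α≰β λ i → dne λ fi≰g →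
    β≮α (i , ≤fi i fi≰g)
    where
    ≤fi : ∀ i → ¬ (∃[ j ] f i ≤ₒ g j) → sup⁺ g ≤ₒ f i
    ≤fi i fi≰g with f i | (λ j → ≰ₒ⇒>ₒ (f i) (g j) (λ fi≤gj → fi≰g (j , fi≤gj)))
    ... | sup⁺ h | g<fi = g<fi

  ⊀⇒≽ : (k k′ : Rank ℓ) → ¬ k ≺ k′ → k′ ≼ k
  ⊀⇒≽ (α , n , e) (β , m , f) k⊀k′ with em {P = β <ₒ α}
  ... | yes β<α = inj₁ β<α
  ... | no β≮α  = inj₂ (β≤α , n-case)
    where
    α≤β = dne (β≮α ∘ ≰ₒ⇒>ₒ α β)
    β≤α = dne (k⊀k′ ∘ inj₁ ∘ ≰ₒ⇒>ₒ β α)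
    n-case : m ℕ.< n ⊎ (m ≡ n × f ℕ.≤ e)
    n-case with em {P = m ℕ.< n}
    ... | yes m<n = inj₁ m<n
    ... | no m≮n  = inj₂ (m≡n , ℕ.≮⇒≥ λ e<f → k⊀k′ (inj₂ (α≤β , inj₂ (sym m≡n , e<f))))
      where
      m≡n = ℕ.≤-antisym (ℕ.≮⇒≥ λ n<m → k⊀k′ (inj₂ (α≤β , inj₁ n<m))) (ℕ.≮⇒≥ m≮n)

  -- From an index `i` where the pair of ordinal and parameter is least, no strict drop can occur.
  -- All later letters are paid out of the budget held at `i`, which bounds their total cost.
  paidPath⇒MeanPayoff<0 : ∀ {u} (k : ℕ → Rank ℓ) →
    (∀ i → Lex (Pays (u i) 1) (k (suc i)) (k i)) → MeanPayoff<0 u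
  paidPath⇒MeanPayoff<0 {ℓ = ℓ} {u} k paid = conclude
    where
    -- With the last component set to 0, `≺` compares only the first two.
    truncate : Rank ℓ → Rank ℓ
    truncate (α , n , _) = α , n , 0

    truncate-least : ∃[ x ] ((∃[ i ] truncate (k i) ≡ x) ×
                             (∀ {y} → (∃[ j ] truncate (k j) ≡ y) → ¬ y ≺ x))
    truncate-least = minimal ≺-wellFounded (_ , 0 , refl)

    i = proj₁ (proj₁ (proj₂ truncate-least))

    least : ∀ j → ¬ truncate (k j) ≺ truncate (k i)
    least j = subst (λ x → ¬ truncate (k j) ≺ x) (sym (proj₂ (proj₁ (proj₂ truncate-least))))
                    (proj₂ (proj₂ truncate-least) (j , refl))

    v : Word ℤ
    v j = u (i ℕ.+ j)

    total : ∀ m → Lex (Pays (prefixSum v m) m) (k (i ℕ.+ m)) (k i)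
    total zero rewrite ℕ.+-identityʳ i =
      inj₂ (≤ₒ-refl _ , inj₂ (refl , ≤-reflexive (lemma (+ suc (proj₁ (proj₂ (k i)))) _)))
      where
      lemma : ∀ d e → d * 0ℤ + 0ℤ + e ≡ e
      lemma = solve-∀
    total (suc m) rewrite ℕ.+-suc i m | prefixSum-suc v m =
      Lex-trans {R = Pays (v m) 1} {Pays (prefixSum v m) m} {Pays (prefixSum v m + v m) (suc m)}
                (λ {n} {e″} {e′} {e} → Pays-step (prefixSum v m) m (v m) {n} {e″} {e′} {e})
                (k (suc (i ℕ.+ m))) (k (i ℕ.+ m)) (k i) (paid (i ℕ.+ m)) (total m)

    bounded : ∀ m → cost (proj₁ (proj₂ (k i))) (prefixSum v m) m ≤ + proj₂ (proj₂ (k i))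
    bounded m with total m
    ... | inj₁ α<α                       = contradiction (inj₁ α<α) (least (i ℕ.+ m))
    ... | inj₂ (α≤α , inj₁ n<n)          = contradiction (inj₂ (α≤α , inj₁ n<n)) (least (i ℕ.+ m))
    ... | inj₂ (_ , inj₂ (_ , pays))     =
      ≤-trans (≤-trans (≤-reflexive (sym (+-identityʳ _)))
                       (+-monoʳ-≤ (cost (proj₁ (proj₂ (k i))) (prefixSum v m) m) (+≤+ z≤n)))
              pays

    conclude : MeanPayoff<0 u
    conclude = costBounded⇒MeanPayoff<0 {u} i (proj₁ (proj₂ (k i))) (+ proj₂ (proj₂ (k i))) bounded

  -- If `s′` entered earlier, the ordinal drops and nothing has to be paid. Otherwise the edge
  -- prolongs paths from `s′` to paths from `s`, so `e` minus the cost of the edge bounds them; the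
  -- one-edge path shows that this is nonnegative.
  Admits-step : (S : Graph ℤ ℓ) (k : Rank ℓ) → ∀ {s w s′} → Admits S k s → Edge S s w s′ →
    ∃[ k′ ] (Lex (Pays w 1) k′ k × Admits S k′ s′)
  Admits-step S (α , n , e) {w = w} {s′} adm s→s′ with em {P = Below S α s′}
  Admits-step S (sup⁺ f , n , e) {w = w} {s′} adm s→s′ | yes (i , n′ , e′ , adm′) =
    (f i , n′ , e′) , inj₁ (i , ≤ₒ-refl (f i)) , adm′
  Admits-step S (α , n , e) {w = w} {s′} adm s→s′ | no s′∉Below =
    (α , n , ∣ e - c ∣′) , inj₂ (≤ₒ-refl α , inj₂ (refl , pays)) , adm′
    where
    c = cost n w 1
    ∣_-_∣′ : ℕ → ℤ → ℕ
    ∣ e - c ∣′ = ∣ + e - c ∣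
    c+[e-c] : ∀ c e → c + (e - c) ≡ e
    c+[e-c] = solve-∀
    e-c≡ : + ∣ e - c ∣′ ≡ + e - c
    e-c≡ = 0≤i⇒+∣i∣≡i (i≤j⇒0≤j-i (subst (_≤ + e) (+-identityʳ c) (adm _ _ (cons s→s′ s′∉Below nil))))
    pays : c + + ∣ e - c ∣′ ≤ + e
    pays = ≤-reflexive (trans (cong (_+_ c) e-c≡) (c+[e-c] c (+ e)))
    adm′ : Admits S (α , n , ∣ e - c ∣′) s′
    adm′ c′ _ path = begin
      c′                    ≡⟨ lemma c c′ ⟨
      (c + c′) - c          ≤⟨ +-monoˡ-≤ (- c) (adm _ _ (cons s→s′ s′∉Below path)) ⟩
      + e - c               ≡⟨ e-c≡ ⟨
      + ∣ e - c ∣′          ∎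
      where
      open ≤-Reasoning
      lemma : ∀ c c′ → (c + c′) - c ≡ c′
      lemma = solve-∀

  -- Every vertex of a winning strategy admits a rank.

  module _ (S : Graph ℤ ℓ) where

    -- One stage is picked for each vertex that admits a rank, and `γ` lies strictly above them all.
    -- The supremum exists because `Vertex S` has the level of the index types of `Ord ℓ`.
    closureOrdinal : ∃[ γ ] ∀ k s → Admits S k s → Below S γ s
    closureOrdinal = sup⁺ stage , below
      where
      stage : Vertex S → Ord ℓ
      stage s with em {P = ∃[ k ] Admits S k s}
      ... | yes ((α , _) , _) = α
      ... | no _              = sup⁺ {I = ⊥} λ ()

      admitted : ∀ k s → Admits S k s → ∃[ n ] ∃[ e ] Admits S (stage s , n , e) s
      admitted k s adm with em {P = ∃[ k ] Admits S k s}
      ... | yes ((_ , n , e) , adm′) = n , e , adm′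
      ... | no ¬adm                  = contradiction (k , adm) ¬adm

      below : ∀ k s → Admits S k s → Below S (sup⁺ stage) s
      below k s adm = s , admitted k s adm

    module _ (sat : Satisfies S MeanPayoff<0)
             (γ : Ord ℓ) (closed : ∀ k s → Admits S k s → Below S γ s) where

      private
        Remaining = Σ (Vertex S) λ s → ¬ Below S γ s

        -- The length and the sum of the letters of a finite play, and its last vertex.
        History = ℕ × ℤ × Remaining

        _⟶_ : Rel History ℓ
        (m , T , s , _) ⟶ (m′ , T′ , s′ , _) = ∃[ w ] (Edge S s w s′ × m′ ≡ suc m × T′ ≡ T + w)

        NonNegCost : ℕ → Pred History _
        NonNegCost n (m , T , _) = 0ℤ ≤ cost n T m

        -- A bound `e` at parameter `n` would let `s` enter at stage `γ`, and by `closed` already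
        -- before it.
        expensive : ∀ n e ((s , _) : Remaining) →
                    ∃[ c ] ∃[ t ] (Path S (Below S γ) n s c t × + e < c)
        expensive n e (s , s∉) = dne λ none → s∉ (closed (γ , n , e) s
          λ _ _ path → ≮⇒≥ λ e<c → none (_ , _ , path , e<c))

        -- The first edge is split off because `TransClosure` needs a nonempty path.
        follow : ∀ {n s w s′ c t} (s∉ : ¬ Below S γ s) → Edge S s w s′ → ¬ Below S γ s′ →
          Path S (Below S γ) n s′ c t → ∀ m T →
          ∃[ m′ ] ∃[ T′ ] ∃[ t∉ ] (TransClosure _⟶_ (m , T , s , s∉) (m′ , T′ , t , t∉) ×
                                   cost n T′ m′ ≡ cost n T m + (cost n w 1 + c))
        follow {n} {w = w} s∉ e s′∉ nil m T =
          suc m , T + w , s′∉ , [ (w , e , refl , refl) ] ,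
          trans (cost-step n T w m) (cong (_+_ (cost n T m)) (sym (+-identityʳ _)))
        follow {n} {w = w} s∉ e s′∉ (cons {c = c} e′ s″∉ path) m T =
          let m′ , T′ , t∉ , steps , eq = follow s′∉ e′ s″∉ path (suc m) (T + w)
          in m′ , T′ , t∉ , (w , e , refl , refl) ∷ steps ,
             trans eq (trans (cong (_+ _) (cost-step n T w m)) (+-assoc (cost n T m) _ _))

        extend : ∀ n h → ∃[ h′ ] (TransClosure _⟶_ h h′ × NonNegCost n h′)
        -- This bound makes the new path outweigh any negative cost so far. It also excludes the
        -- empty path, whose cost is 0.
        extend n (m , T , s , s∉) with expensive n ∣ - cost n T m ∣ (s , s∉)
        ... | _ , _ , nil , +<+ ()
        ... | _ , t , cons e s′∉ path , lt =
          let m′ , T′ , t∉ , steps , eq = follow s∉ e s′∉ path m T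
          in (m′ , T′ , t , t∉) , steps , subst (0ℤ ≤_) (sym eq) (begin
            0ℤ                                   ≡⟨ +-inverseʳ (cost n T m) ⟨
            cost n T m + - cost n T m            ≤⟨ +-monoʳ-≤ (cost n T m) (i≤+∣i∣ (- cost n T m)) ⟩
            cost n T m + + ∣ - cost n T m ∣      ≤⟨ +-monoʳ-≤ (cost n T m) (<⇒≤ lt) ⟩
            cost n T m + _                       ∎)
          where open ≤-Reasoning

      all-below : ∀ s → Below S γ s
      all-below s = dne λ s∉ → impossible (infinitePath (0 , 0ℤ , s , s∉))
        where
        open Concatenation _⟶_ NonNegCost extend using (infinitePath)

        impossible : ∀ {s₀} → ¬ (Σ[ h ∈ (ℕ → History) ]
          (h 0 ≡ (0 , 0ℤ , s₀) × (∀ i → h i ⟶ h (suc i)) ×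
           (∀ n → ∃[ j ] (n ℕ.≤ j × NonNegCost n (h (suc j))))))
        impossible (h , h0 , step , nonNeg) =
          -- Stage `n + N` serves twice: its time is past `N`, and its parameter is at least the `n`
          -- of the drift.
          <⇒≱ (cost<0 j (ℕ.m+n≤o⇒n≤o n n+N≤j))
              (cost-nonneg-anti (prefixSum u (suc j)) (suc j) (ℕ.m≤m+n n N)
                (subst₂ (λ T m → 0ℤ ≤ cost (n ℕ.+ N) T m) (sum≡ (suc j)) (length≡ (suc j)) nn))
          where
          u : Word ℤ
          u i = proj₁ (step i)

          length≡ : ∀ i → proj₁ (h i) ≡ i
          length≡ zero    = cong proj₁ h0
          length≡ (suc i) = trans (proj₁ (proj₂ (proj₂ (step i)))) (cong suc (length≡ i))

          sum≡ : ∀ i → proj₁ (proj₂ (h i)) ≡ prefixSum u i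
          sum≡ zero    = cong (proj₁ ∘ proj₂) h0
          sum≡ (suc i) = trans (proj₂ (proj₂ (proj₂ (step i))))
                               (trans (cong (_+ u i) (sum≡ i)) (sym (prefixSum-suc u i)))

          drift = MeanPayoff<0⇒cost<0 {u}
            (sat {u} ((λ i → proj₁ (proj₂ (proj₂ (h i)))) , λ i → proj₁ (proj₂ (step i))))
          n      = proj₁ drift
          N      = proj₁ (proj₂ drift)
          cost<0 = proj₂ (proj₂ drift)
          j      = proj₁ (nonNeg (n ℕ.+ N))
          n+N≤j  = proj₁ (proj₂ (nonNeg (n ℕ.+ N)))
          nn     = proj₂ (proj₂ (nonNeg (n ℕ.+ N)))

    below⇒admits : ∀ α s → Below S α s → ∃[ k ] Admits S k s
    below⇒admits (sup⁺ f) s (i , n , e , adm) = (f i , n , e) , adm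

    abstract
      admits-some : Satisfies S MeanPayoff<0 → ∀ s → ∃[ k ] Admits S k s
      admits-some sat s = let γ , closed = closureOrdinal
                          in below⇒admits γ s (all-below sat γ closed s)

  -- The positional strategy on the arena.

  module _ (A : Arena ℤ ℓ) (σ : Strategy A) (wins : WinsWith σ MeanPayoff<0) where
    open Arena A
    open Strategy σ

    private
      FibreAdmits : Vertex graph → Rank ℓ → Set ℓ
      FibreAdmits v k = ∃[ s ] (π s ≡ v × Admits S k s)

      least : ∀ v → ∃[ k ] (FibreAdmits v k × ∀ {k′} → FibreAdmits v k′ → ¬ k′ ≺ k)
      least v = minimal {_<_ = _≺_} {P = FibreAdmits v} ≺-wellFounded
        (let s , πs≡v = surjective v ; k , adm = admits-some S wins s in k , s , πs≡v refl , adm)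

      φ : Vertex graph → Rank ℓ
      φ v = proj₁ (least v)

      lift : ∀ v → FibreAdmits v (φ v)
      lift v = proj₁ (proj₂ (least v))

      Kept : Vertex graph → ℤ → Vertex graph → Set ℓ
      Kept v w v′ = Edge graph v w v′ × Lex (Pays w 1) (φ v′) (φ v)

      -- `Admits-step` gives `s′` a paid rank. The least rank of its fibre is no larger, and
      -- lowering the rank of the target keeps the edge paid.
      image-paid : ∀ {v s w s′} → Admits S (φ v) s → Edge S s w s′ →
                   Lex (Pays w 1) (φ (π s′)) (φ v)
      image-paid {v} {w = w} {s′} adm s→s′ =
        let k′ , paid , adm′ = Admits-step S (φ v) adm s→s′
        in Lex-trans {R = λ _ → ℕ._≤_} {Pays w 1} {Pays w 1}
             (λ {n} e≤f pays → ≤-trans (+-monoʳ-≤ (cost n w 1) (+≤+ e≤f)) pays)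
             (φ (π s′)) k′ (φ v)
             (⊀⇒≽ k′ (φ (π s′)) (proj₂ (proj₂ (least (π s′))) (s′ , refl , adm′))) paid

      kept : ∀ v → ∃[ w ] ∃[ v′ ] Kept v w v′
      kept v = let s , πs≡v , adm = lift v ; w , s′ , e = sinkless S s
               in w , π s′ , subst (λ v → Edge graph v w (π s′)) πs≡v (Morphism.preserves pi e) ,
                  image-paid {v} adm e

      adamKept : ∀ v → owner v ≡ Adam → ∀ {w v′} → Edge graph v w v′ → Kept v w v′
      adamKept v adam {w} {v′} e with lift v
      ... | s , refl , adm with adamMoves s adam e
      ...   | s′ , e′ , refl = e , image-paid {v} adm e′

    positionalStrategy : Strategy A
    positionalStrategy = record
      { S          = record { Vertex = Vertex graph ; Edge = Kept ; sinkless = kept }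
      ; pi         = record { map = id ; preserves = proj₁ }
      ; surjective = λ v → v , id
      ; adamMoves  = λ v adam e → _ , adamKept v adam e , refl
      }

    positionalStrategy-wins : WinsWith positionalStrategy MeanPayoff<0
    positionalStrategy-wins {u} (v , edges) = paidPath⇒MeanPayoff<0 {u = u} (φ ∘ v) (proj₂ ∘ edges)

proposition4p3 : (∀ {a} → ExcludedMiddle a) → ∀ ℓ → PositionalOverArenas ℓ MeanPayoff<0
proposition4p3 em ℓ A (σ , wins) =
  positionalStrategy A σ wins , id , positionalStrategy-wins A σ wins
  where open Classical em
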